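{- For every positive integer $n$, the group $\mathrm{AGL}(n,2)$, in its natural action on $V=\mathbb{F}_2^n$, satisfies the strict-EKR property: every intersecting subset of $\mathrm{AGL}(n,2)$ of maximum possible size is of the form $\{g\in\mathrm{AGL}(n,2): g(\alpha)=\beta\}$ for some $\alpha,\beta\in V$.
   Context: $\mathrm{AGL}(n,2)=\mathrm{GL}(n,2)\ltimes V$, where $V=\mathbb{F}_2^n$; its elements are pairs $(M,v)$ with $M\in\mathrm{GL}(n,2)$, $v\in V$, with product $(M_1,v_1)(M_2,v_2)=(M_1M_2,v_1+M_1v_2)$, acting on $V$ by $(M,v)\cdot w=v+Mw$. For a finite permutation group $G\le\mathrm{Sym}(\Omega)$, two elements $g_1,g_2\in G$ are intersecting if $g_1g_2^{ -1}$ fixes a point of $\Omega$; a subset $S\subseteq G$ is an intersecting set if every pair of its elements is intersecting. The sets $\mathcal{S}_{\alpha\to\beta}=\{g\in G: g(\alpha)=\beta\}$ ($\alpha,\beta\in\Omega$) are the canonical intersecting sets. $G$ satisfies the strict-EKR property if every intersecting set of maximum possible size in $G$ is canonical. -}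

module Defs where

open import Data.Nat using (ℕ; _≤_)
open import Data.Bool using (Bool; true; false; _∧_; _xor_)
open import Data.Fin using (Fin; _≟_)
open import Data.Vec using (Vec; map; zipWith; foldr; tabulate; transpose)
open import Data.Product using (Σ; _×_; _,_; proj₁; proj₂; ∃)
open import Data.List using (List; length)
open import Data.List.Membership.Propositional using (_∈_)
open import Data.List.Relation.Unary.Any using (Any)
open import Data.List.Relation.Unary.AllPairs using (AllPairs)
open import Relation.Binary.PropositionalEquality using (_≡_)
open import Relation.Nullary using (¬_; does)
open import Function.Bundles using (_⇔_)

-- The field F₂ is Bool with _xor_ as addition and _∧_ as multiplication.
-- V = F₂ⁿ
V : ℕ → Set
V n = Vec Bool n

-- n × n matrices over F₂, stored as a vector of rows.
Mat : ℕ → Set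
Mat n = Vec (Vec Bool n) n

_⊕_ : ∀ {n} → V n → V n → V n
_⊕_ = zipWith _xor_

dot : ∀ {n} → V n → V n → Bool
dot u w = foldr _ _xor_ false (zipWith _∧_ u w)

_·ᵥ_ : ∀ {n} → Mat n → V n → V n
M ·ᵥ w = map (λ row → dot row w) M

_·ₘ_ : ∀ {n} → Mat n → Mat n → Mat n
M ·ₘ N = map (λ row → map (λ col → dot row col) (transpose N)) M

I : ∀ {n} → Mat n
I = tabulate λ i → tabulate λ j → does (i ≟ j)

IsInvertible : ∀ {n} → Mat n → Set
IsInvertible {n} M = Σ (Mat n) λ N → (M ·ₘ N ≡ I) × (N ·ₘ M ≡ I)

AGL : ℕ → Set
AGL n = Σ (Mat n × V n) λ p → IsInvertible (proj₁ p)

-- underlying pair (M , v); two group elements are equal iff these agree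
elt : ∀ {n} → AGL n → Mat n × V n
elt = proj₁

-- product on underlying pairs: (M₁,v₁)(M₂,v₂) = (M₁M₂, v₁ + M₁v₂)
-- (closure of GL(n,2) under products is not needed for the statement,
--  so we multiply the underlying pairs directly)
_∙_ : ∀ {n} → Mat n × V n → Mat n × V n → Mat n × V n
(M₁ , v₁) ∙ (M₂ , v₂) = (M₁ ·ₘ M₂ , v₁ ⊕ (M₁ ·ᵥ v₂))

-- inverse of (M , v) is (M⁻¹ , -M⁻¹v) = (M⁻¹ , M⁻¹v) over F₂,
-- where M⁻¹ is the inverse supplied by the invertibility witness
_⁻¹ : ∀ {n} → AGL n → Mat n × V n
((M , v) , (N , _)) ⁻¹ = (N , N ·ᵥ v)

act : ∀ {n} → Mat n × V n → V n → V n
act (M , v) w = v ⊕ (M ·ᵥ w)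

Intersect : ∀ {n} → AGL n → AGL n → Set
Intersect {n} g₁ g₂ = ∃ λ (w : V n) → act (elt g₁ ∙ (g₂ ⁻¹)) w ≡ w

-- finite subsets of AGL(n,2): duplicate-free lists (as group elements)
Distinct : ∀ {n} → List (AGL n) → Set
Distinct = AllPairs (λ g h → ¬ (elt g ≡ elt h))

_∈G_ : ∀ {n} → AGL n → List (AGL n) → Set
g ∈G S = Any (λ h → elt h ≡ elt g) S

IsIntersecting : ∀ {n} → List (AGL n) → Set
IsIntersecting S = ∀ {g h} → g ∈ S → h ∈ S → Intersect g h

IsMaxIntersecting : ∀ {n} → List (AGL n) → Set
IsMaxIntersecting {n} S =
  Distinct S × IsIntersecting S ×
  (∀ (T : List (AGL n)) → Distinct T → IsIntersecting T → length T ≤ length S)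

IsCanonical : ∀ {n} → List (AGL n) → Set
IsCanonical {n} S = ∃ λ (α : V n) → ∃ λ (β : V n) →
  ∀ (g : AGL n) → (g ∈G S) ⇔ (act (elt g) α ≡ β)

StrictEKR : ℕ → Set
StrictEKR n = ∀ (S : List (AGL n)) → IsMaxIntersecting S → IsCanonical S

{-# OPTIONS --safe #-}
module Submission where

-- A maximum intersecting set contains exactly one (M , v) for every M in
-- GL(n,2), for otherwise all its linear parts, with one missing M added, would
-- form a larger intersecting set. If (M₁ , v₁) and (M₂ , v₂) intersect, then
-- v₁ + v₂ lies in the image of M₁ + M₂; dually, a row vector u with u M₁ = u M₂
-- satisfies u v₁ = u v₂. Hence u v is a function F(u, u M) of the pair (u, u M).
-- As GL(n,2) is 2-transitive on nonzero vectors (two transvections suffice),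
-- F(a + b, c + d) = F(a, c) + F(b, d) for distinct nonzero a, b and distinct
-- nonzero c, d. The left side is symmetric in c and d, so F(a, c) = g(a) + h(c);
-- then g(a + b) + g(a) + g(b) and h(c + d) + h(c) + h(d) are the same constant k,
-- and g + k, h + k are linear, say g(a) + k = a β and h(c) + k = c α. Therefore
-- u v = u β + u M α for all u, that is, v = β + M α.

open import Defs
open import Data.Nat using (ℕ; _≤_)

open import Data.Nat using (zero; suc)
open import Data.Nat.Properties using (1+n≰n)
open import Data.Bool using (Bool; true; false; _∧_; _xor_; if_then_else_)
import Data.Bool.Properties as Bool
open import Data.Bool.Solver using (module xor-∧-Solver)
open import Data.Fin using (Fin; zero; suc; _≟_)
open import Data.Vec using (Vec; []; _∷_; map; replicate; tabulate; lookup; transpose; _⊛_)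
import Data.Vec.Properties as Vec
open import Data.Product using (_×_; _,_; proj₁; proj₂; ∃; ∃₂)
open import Data.Sum using (_⊎_; inj₁; inj₂)
open import Data.List using (List; _∷_; length)
import Data.List as List
import Data.List.Properties as List
open import Data.List.Membership.Propositional using (_∈_; find; lose)
open import Data.List.Membership.Propositional.Properties using (∈-map⁻)
open import Data.List.Relation.Unary.Any using (Any; any?; here; there)
import Data.List.Relation.Unary.All as All
import Data.List.Relation.Unary.All.Properties as All
open import Data.List.Relation.Unary.AllPairs using (AllPairs; []; _∷_)
import Data.List.Relation.Unary.AllPairs.Properties as AllPairs
open import Algebra.Bundles using (CommutativeSemigroup)
import Algebra.Properties.CommutativeSemigroup as CommutativeSemigroupProperties
open import Function using (_∘_)
open import Function.Bundles using (mk⇔)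
open import Relation.Binary.PropositionalEquality
open import Relation.Binary.Definitions using (DecidableEquality)
open import Relation.Nullary using (¬_; Dec; yes; no; does; contradiction)
open import Relation.Nullary.Decidable using (dec-true; dec-false; decidable-stable)

open ≡-Reasoning
open xor-∧-Solver using (solve; _:+_; _:*_; _:=_; con)

private
  variable
    m n : ℕ

-- Moving terms across equations in F₂

xor-transposeʳ : ∀ {x y z} → x xor y ≡ z → x ≡ z xor y
xor-transposeʳ {x} {y} refl = solve 2 (λ x y → x := (x :+ y) :+ y) refl x y

xor-cancelʳ : ∀ {x y} z → x xor z ≡ y xor z → x ≡ y
xor-cancelʳ {x} {y} z p =
  trans (xor-transposeʳ p) (solve 2 (λ y z → (y :+ z) :+ z := y) refl y z)

-- Linear algebra over F₂

_≟ᵥ_ : DecidableEquality (V n)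
_≟ᵥ_ = Vec.≡-dec Bool._≟_

𝟎 : V n
𝟎 = replicate _ false

⊕-comm : (u v : V n) → u ⊕ v ≡ v ⊕ u
⊕-comm = Vec.zipWith-comm Bool.xor-comm

⊕-assoc : (u v w : V n) → (u ⊕ v) ⊕ w ≡ u ⊕ (v ⊕ w)
⊕-assoc = Vec.zipWith-assoc Bool.xor-assoc

⊕-identityˡ : (v : V n) → 𝟎 ⊕ v ≡ v
⊕-identityˡ = Vec.zipWith-identityˡ Bool.xor-identityˡ

⊕-identityʳ : (v : V n) → v ⊕ 𝟎 ≡ v
⊕-identityʳ = Vec.zipWith-identityʳ Bool.xor-identityʳ

⊕-self : (v : V n) → v ⊕ v ≡ 𝟎
⊕-self []      = refl
⊕-self (x ∷ v) = cong₂ _∷_ (Bool.xor-same x) (⊕-self v)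

⊕-cancel-selfˡ : (u v : V n) → u ⊕ (u ⊕ v) ≡ v
⊕-cancel-selfˡ u v = begin
  u ⊕ (u ⊕ v)  ≡⟨ ⊕-assoc u u v ⟨
  (u ⊕ u) ⊕ v  ≡⟨ cong (_⊕ v) (⊕-self u) ⟩
  𝟎 ⊕ v        ≡⟨ ⊕-identityˡ v ⟩
  v            ∎

⊕-cancel-selfʳ : (u v : V n) → (u ⊕ v) ⊕ v ≡ u
⊕-cancel-selfʳ u v = begin
  (u ⊕ v) ⊕ v  ≡⟨ cong (_⊕ v) (⊕-comm u v) ⟩
  (v ⊕ u) ⊕ v  ≡⟨ ⊕-comm (v ⊕ u) v ⟩
  v ⊕ (v ⊕ u)  ≡⟨ ⊕-cancel-selfˡ v u ⟩
  u            ∎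

⊕-commutativeSemigroup : ℕ → CommutativeSemigroup _ _
⊕-commutativeSemigroup n = record
  { Carrier = V n ; _≈_ = _≡_ ; _∙_ = _⊕_
  ; isCommutativeSemigroup = record
    { isSemigroup = record
      { isMagma = record { isEquivalence = isEquivalence ; ∙-cong = cong₂ _⊕_ }
      ; assoc   = ⊕-assoc }
    ; comm = ⊕-comm }
  }

⊕-interchange : (u v w x : V n) → (u ⊕ v) ⊕ (w ⊕ x) ≡ (u ⊕ w) ⊕ (v ⊕ x)
⊕-interchange {n} = CommutativeSemigroupProperties.interchange (⊕-commutativeSemigroup n)

⊕≡𝟎⇒≡ : {u v : V n} → u ⊕ v ≡ 𝟎 → u ≡ v
⊕≡𝟎⇒≡ {u = u} {v} p = begin
  u            ≡⟨ ⊕-cancel-selfʳ u v ⟨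
  (u ⊕ v) ⊕ v  ≡⟨ cong (_⊕ v) p ⟩
  𝟎 ⊕ v        ≡⟨ ⊕-identityˡ v ⟩
  v            ∎

scale : Bool → V n → V n
scale b = map (b ∧_)

scale-true : (v : V n) → scale true v ≡ v
scale-true = Vec.map-id

scale-false : (v : V n) → scale false v ≡ 𝟎
scale-false v = Vec.map-const v false

scale-xor : ∀ b c (v : V n) → scale (b xor c) v ≡ scale b v ⊕ scale c v
scale-xor b c []      = refl
scale-xor b c (x ∷ v) = cong₂ _∷_ (Bool.∧-distribʳ-xor x b c) (scale-xor b c v)

-- The dot product

dot-comm : (u v : V n) → dot u v ≡ dot v u
dot-comm []      []      = refl
dot-comm (x ∷ u) (y ∷ v) = cong₂ _xor_ (Bool.∧-comm x y) (dot-comm u v)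

dot-⊕ˡ : (u v w : V n) → dot (u ⊕ v) w ≡ dot u w xor dot v w
dot-⊕ˡ []      []      []      = refl
dot-⊕ˡ (x ∷ u) (y ∷ v) (z ∷ w) = begin
  ((x xor y) ∧ z) xor dot (u ⊕ v) w                  ≡⟨ cong (((x xor y) ∧ z) xor_) (dot-⊕ˡ u v w) ⟩
  ((x xor y) ∧ z) xor (dot u w xor dot v w)          ≡⟨ solve 5 (λ x y z p q →
      ((x :+ y) :* z) :+ (p :+ q) := ((x :* z) :+ p) :+ ((y :* z) :+ q)) refl x y z (dot u w) (dot v w) ⟩
  ((x ∧ z) xor dot u w) xor ((y ∧ z) xor dot v w)    ∎

dot-⊕ʳ : (u v w : V n) → dot u (v ⊕ w) ≡ dot u v xor dot u w
dot-⊕ʳ u v w = begin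
  dot u (v ⊕ w)          ≡⟨ dot-comm u (v ⊕ w) ⟩
  dot (v ⊕ w) u          ≡⟨ dot-⊕ˡ v w u ⟩
  dot v u xor dot w u    ≡⟨ cong₂ _xor_ (dot-comm v u) (dot-comm w u) ⟩
  dot u v xor dot u w    ∎

dot-𝟎ˡ : (v : V n) → dot 𝟎 v ≡ false
dot-𝟎ˡ []      = refl
dot-𝟎ˡ (x ∷ v) = dot-𝟎ˡ v

dot-𝟎ʳ : (v : V n) → dot v 𝟎 ≡ false
dot-𝟎ʳ v = trans (dot-comm v 𝟎) (dot-𝟎ˡ v)

dot-scaleˡ : ∀ b (u v : V n) → dot (scale b u) v ≡ b ∧ dot u v
dot-scaleˡ true  u v = cong (λ u′ → dot u′ v) (scale-true u)
dot-scaleˡ false u v = trans (cong (λ u′ → dot u′ v) (scale-false u)) (dot-𝟎ˡ v)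

dot-scaleʳ : ∀ b (u v : V n) → dot u (scale b v) ≡ b ∧ dot u v
dot-scaleʳ b u v = begin
  dot u (scale b v)  ≡⟨ dot-comm u (scale b v) ⟩
  dot (scale b v) u  ≡⟨ dot-scaleˡ b v u ⟩
  b ∧ dot v u        ≡⟨ cong (b ∧_) (dot-comm v u) ⟩
  b ∧ dot u v        ∎

-- The test vector `true ∷ 𝟎` isolates the head, and the vectors `false ∷ u` the tail. Later vector
-- identities are reduced to scalar ones this way.
dot-ext : {v w : V n} → (∀ u → dot u v ≡ dot u w) → v ≡ w
dot-ext {v = []}    {[]}    p = refl
dot-ext {v = x ∷ v} {y ∷ w} p = cong₂ _∷_ x≡y (dot-ext (λ u → p (false ∷ u)))
  where
  x≡y : x ≡ y
  x≡y = begin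
    x                    ≡⟨ Bool.xor-identityʳ x ⟨
    x xor false          ≡⟨ cong (x xor_) (dot-𝟎ˡ v) ⟨
    x xor dot 𝟎 v        ≡⟨ p (true ∷ 𝟎) ⟩
    y xor dot 𝟎 w        ≡⟨ cong (y xor_) (dot-𝟎ˡ w) ⟩
    y xor false          ≡⟨ Bool.xor-identityʳ y ⟩
    y                    ∎

-- Standard basis and the action of matrices on rows and columns

e : Fin n → V n
e i = tabulate λ j → does (i ≟ j)

tabulate-false : tabulate {n = n} (λ _ → false) ≡ 𝟎
tabulate-false {zero}  = refl
tabulate-false {suc n} = cong (false ∷_) tabulate-false

dot-e : (i : Fin n) (v : V n) → dot (e i) v ≡ lookup v i
dot-e zero    (x ∷ v) = begin
  x xor dot (tabulate (λ _ → false)) v  ≡⟨ cong (λ u → x xor dot u v) tabulate-false ⟩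
  x xor dot 𝟎 v                         ≡⟨ cong (x xor_) (dot-𝟎ˡ v) ⟩
  x xor false                           ≡⟨ Bool.xor-identityʳ x ⟩
  x                                     ∎
dot-e (suc i) (x ∷ v) = dot-e i v

-- The action of a matrix on row vectors, chosen so that M ·ₘ N = map (_◃ N) M
-- holds definitionally.
_◃_ : V m → Vec (V n) m → V n
u ◃ M = map (dot u) (transpose M)

-- Inductive step of `dot-◃`: `transpose (r ∷ M)` unfolds to this applicative expression, with `T`
-- in place of `transpose M`.
dot-map-∷ : ∀ b (u : V m) (r : V n) (T : Vec (V m) n) w →
            dot (map (dot (b ∷ u)) ((replicate n _∷_ ⊛ r) ⊛ T)) w
            ≡ (b ∧ dot r w) xor dot (map (dot u) T) w
dot-map-∷ b u []      []      []      = solve 1 (λ b → con false := (b :* con false) :+ con false) refl b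
dot-map-∷ b u (x ∷ r) (t ∷ T) (y ∷ w) = begin
  (((b ∧ x) xor dot u t) ∧ y) xor dot (map (dot (b ∷ u)) ((replicate _ _∷_ ⊛ r) ⊛ T)) w
    ≡⟨ cong ((((b ∧ x) xor dot u t) ∧ y) xor_) (dot-map-∷ b u r T w) ⟩
  (((b ∧ x) xor dot u t) ∧ y) xor ((b ∧ dot r w) xor dot (map (dot u) T) w)
    ≡⟨ solve 6 (λ b x y p q s →
         (((b :* x) :+ p) :* y) :+ ((b :* q) :+ s) := (b :* ((x :* y) :+ q)) :+ ((p :* y) :+ s))
         refl b x y (dot u t) (dot r w) (dot (map (dot u) T) w) ⟩
  (b ∧ ((x ∧ y) xor dot r w)) xor ((dot u t ∧ y) xor dot (map (dot u) T) w) ∎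

-- Associativity (uM)w = u(Mw), by induction on the rows of `M`. It lets the row action and the
-- column action be traded for each other.
dot-◃ : (u : V m) (M : Vec (V n) m) (w : V n) → dot (u ◃ M) w ≡ dot u (map (λ r → dot r w) M)
dot-◃ {n = n} [] [] w = begin
  dot (map (dot []) (replicate n [])) w  ≡⟨ cong (λ u → dot u w) (Vec.map-replicate (dot []) [] n) ⟩
  dot 𝟎 w                                ≡⟨ dot-𝟎ˡ w ⟩
  false                                  ∎
dot-◃ (b ∷ u) (r ∷ M) w = begin
  dot ((b ∷ u) ◃ (r ∷ M)) w                              ≡⟨ dot-map-∷ b u r (transpose M) w ⟩
  (b ∧ dot r w) xor dot (u ◃ M) w                        ≡⟨ cong ((b ∧ dot r w) xor_) (dot-◃ u M w) ⟩
  (b ∧ dot r w) xor dot u (map (λ r′ → dot r′ w) M)      ∎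

◃-⊕ : (u v : V m) (M : Vec (V n) m) → (u ⊕ v) ◃ M ≡ (u ◃ M) ⊕ (v ◃ M)
◃-⊕ u v M = map-dot-⊕ (transpose M)
  where
  map-dot-⊕ : ∀ {k} (T : Vec (V _) k) → map (dot (u ⊕ v)) T ≡ map (dot u) T ⊕ map (dot v) T
  map-dot-⊕ []      = refl
  map-dot-⊕ (t ∷ T) = cong₂ _∷_ (dot-⊕ˡ u v t) (map-dot-⊕ T)

·ᵥ-⊕ : (M : Mat n) (v w : V n) → M ·ᵥ (v ⊕ w) ≡ (M ·ᵥ v) ⊕ (M ·ᵥ w)
·ᵥ-⊕ M v w = dot-ext λ u → begin
  dot u (M ·ᵥ (v ⊕ w))                  ≡⟨ dot-◃ u M (v ⊕ w) ⟨
  dot (u ◃ M) (v ⊕ w)                   ≡⟨ dot-⊕ʳ (u ◃ M) v w ⟩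
  dot (u ◃ M) v xor dot (u ◃ M) w       ≡⟨ cong₂ _xor_ (dot-◃ u M v) (dot-◃ u M w) ⟩
  dot u (M ·ᵥ v) xor dot u (M ·ᵥ w)     ≡⟨ dot-⊕ʳ u (M ·ᵥ v) (M ·ᵥ w) ⟨
  dot u ((M ·ᵥ v) ⊕ (M ·ᵥ w))           ∎

·ᵥ-𝟎 : (M : Mat n) → M ·ᵥ 𝟎 ≡ 𝟎
·ᵥ-𝟎 M = trans (Vec.map-cong dot-𝟎ʳ M) (Vec.map-const M false)

·ₘ-·ᵥ : (M N : Mat n) (w : V n) → (M ·ₘ N) ·ᵥ w ≡ M ·ᵥ (N ·ᵥ w)
·ₘ-·ᵥ M N w = begin
  map (λ r → dot r w) (map (_◃ N) M)  ≡⟨ Vec.map-∘ (λ r → dot r w) (_◃ N) M ⟨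
  map (λ r → dot (r ◃ N) w) M         ≡⟨ Vec.map-cong (λ r → dot-◃ r N w) M ⟩
  M ·ᵥ (N ·ᵥ w)                       ∎

I-·ᵥ : (w : V n) → I ·ᵥ w ≡ w
I-·ᵥ w = begin
  map (λ r → dot r w) (tabulate e)  ≡⟨ Vec.tabulate-∘ (λ r → dot r w) e ⟨
  tabulate (λ i → dot (e i) w)      ≡⟨ Vec.tabulate-cong (λ i → dot-e i w) ⟩
  tabulate (lookup w)               ≡⟨ Vec.tabulate∘lookup w ⟩
  w                                 ∎

-- If uM = 0, then uw = uM(Nw) = 0 for every w, so u = 0.
◃-≢𝟎 : {M : Mat n} → IsInvertible M → ∀ {u} → u ≢ 𝟎 → u ◃ M ≢ 𝟎
◃-≢𝟎 {M = M} (N , MN≡I , _) {u} u≢𝟎 uM≡𝟎 = u≢𝟎 (dot-ext λ w → begin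
  dot w u                       ≡⟨ dot-comm w u ⟩
  dot u w                       ≡⟨ cong (dot u) (I-·ᵥ w) ⟨
  dot u (I ·ᵥ w)                ≡⟨ cong (λ A → dot u (A ·ᵥ w)) MN≡I ⟨
  dot u ((M ·ₘ N) ·ᵥ w)         ≡⟨ cong (dot u) (·ₘ-·ᵥ M N w) ⟩
  dot u (M ·ᵥ (N ·ᵥ w))         ≡⟨ dot-◃ u M (N ·ᵥ w) ⟨
  dot (u ◃ M) (N ·ᵥ w)          ≡⟨ cong (λ v → dot v (N ·ᵥ w)) uM≡𝟎 ⟩
  dot 𝟎 (N ·ᵥ w)                ≡⟨ dot-𝟎ˡ (N ·ᵥ w) ⟩
  false                         ≡⟨ dot-𝟎ʳ w ⟨
  dot w 𝟎                       ∎)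

-- Linear functionals, automorphisms of V and their matrices

Additive : (V n → Bool) → Set
Additive f = ∀ u v → f (u ⊕ v) ≡ f u xor f v

additive-𝟎 : (f : V n → Bool) → Additive f → f 𝟎 ≡ false
additive-𝟎 f f-⊕ = begin
  f 𝟎            ≡⟨ cong f (⊕-self 𝟎) ⟨
  f (𝟎 ⊕ 𝟎)      ≡⟨ f-⊕ 𝟎 𝟎 ⟩
  f 𝟎 xor f 𝟎    ≡⟨ Bool.xor-same (f 𝟎) ⟩
  false          ∎

-- Over F₂ additivity already is linearity, so `f` is determined by its values on the standard
-- basis, which become the coefficients.
additive⇒dot : (f : V n → Bool) → Additive f → ∀ u → f u ≡ dot u (tabulate (f ∘ e))
additive⇒dot f f-⊕ []      = additive-𝟎 f f-⊕
additive⇒dot f f-⊕ (b ∷ u) = step b (additive⇒dot (f ∘ (false ∷_)) (λ v w → f-⊕ (false ∷ v) (false ∷ w)) u)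
  where
  step : ∀ b → f (false ∷ u) ≡ dot u (tabulate (f ∘ e ∘ suc)) → f (b ∷ u) ≡ dot (b ∷ u) (tabulate (f ∘ e))
  step false ih = ih
  step true  ih = begin
    f (true ∷ u)                                       ≡⟨ cong (f ∘ (true ∷_)) (⊕-identityˡ u) ⟨
    f ((true ∷ 𝟎) ⊕ (false ∷ u))                       ≡⟨ f-⊕ (true ∷ 𝟎) (false ∷ u) ⟩
    f (true ∷ 𝟎) xor f (false ∷ u)                     ≡⟨ cong₂ _xor_ (cong (f ∘ (true ∷_)) (sym tabulate-false)) ih ⟩
    f (e zero) xor dot u (tabulate (f ∘ e ∘ suc))      ∎

-- Invertible linear maps are kept as functions, so that composing and inverting them involves no
-- matrix products; `matrix-invertible` passes to matrices at the end.
record Automorphism (n : ℕ) : Set where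
  field
    to from : V n → V n
    to-⊕    : ∀ u v → to (u ⊕ v) ≡ to u ⊕ to v
    from-⊕  : ∀ u v → from (u ⊕ v) ≡ from u ⊕ from v
    to∘from : ∀ v → to (from v) ≡ v
    from∘to : ∀ v → from (to v) ≡ v

  to-𝟎 : to 𝟎 ≡ 𝟎
  to-𝟎 = begin
    to 𝟎          ≡⟨ cong to (⊕-self 𝟎) ⟨
    to (𝟎 ⊕ 𝟎)    ≡⟨ to-⊕ 𝟎 𝟎 ⟩
    to 𝟎 ⊕ to 𝟎   ≡⟨ ⊕-self (to 𝟎) ⟩
    𝟎             ∎

  to-injective : ∀ {u v} → to u ≡ to v → u ≡ v
  to-injective {u} {v} p = trans (sym (from∘to u)) (trans (cong from p) (from∘to v))

open Automorphism

_∘ᵃ_ : Automorphism n → Automorphism n → Automorphism n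
g ∘ᵃ f = record
  { to      = to g ∘ to f
  ; from    = from f ∘ from g
  ; to-⊕    = λ u v → trans (cong (to g) (to-⊕ f u v)) (to-⊕ g _ _)
  ; from-⊕  = λ u v → trans (cong (from f) (from-⊕ g u v)) (from-⊕ f _ _)
  ; to∘from = λ v → trans (cong (to g) (to∘from f _)) (to∘from g v)
  ; from∘to = λ v → trans (cong (from f) (from∘to g _)) (from∘to f v)
  }

-- The images of the basis are the rows, because the maps act on row vectors.
matrix : (V n → V n) → Mat n
matrix f = tabulate (f ∘ e)

◃-matrix : (f : V n → V n) → (∀ u v → f (u ⊕ v) ≡ f u ⊕ f v) → ∀ u → u ◃ matrix f ≡ f u
◃-matrix f f-⊕ u = dot-ext λ w → begin
  dot w (u ◃ matrix f)                     ≡⟨ dot-comm w _ ⟩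
  dot (u ◃ matrix f) w                     ≡⟨ dot-◃ u (matrix f) w ⟩
  dot u (map (λ r → dot r w) (matrix f))   ≡⟨ cong (dot u) (Vec.tabulate-∘ (λ r → dot r w) (f ∘ e)) ⟨
  dot u (tabulate (λ i → dot (f (e i)) w)) ≡⟨ additive⇒dot (λ v → dot (f v) w)
                                                (λ v v′ → trans (cong (λ x → dot x w) (f-⊕ v v′)) (dot-⊕ˡ (f v) (f v′) w)) u ⟨
  dot (f u) w                              ≡⟨ dot-comm (f u) w ⟩
  dot w (f u)                              ∎

-- On row vectors the left factor acts first, so the product represents `g ∘ f`.
matrix-inverse : (f g : V n → V n) → (∀ u v → g (u ⊕ v) ≡ g u ⊕ g v) → (∀ v → g (f v) ≡ v) →
                 matrix f ·ₘ matrix g ≡ I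
matrix-inverse f g g-⊕ g∘f = begin
  map (_◃ matrix g) (tabulate (f ∘ e))   ≡⟨ Vec.tabulate-∘ (_◃ matrix g) (f ∘ e) ⟨
  tabulate (λ i → f (e i) ◃ matrix g)    ≡⟨ Vec.tabulate-cong (λ i → trans (◃-matrix g g-⊕ (f (e i))) (g∘f (e i))) ⟩
  I                                      ∎

matrix-invertible : (f : Automorphism n) → IsInvertible (matrix (to f))
matrix-invertible f =
  matrix (from f) ,
  matrix-inverse (to f) (from f) (from-⊕ f) (from∘to f) ,
  matrix-inverse (from f) (to f) (to-⊕ f) (to∘from f)

-- Transvections and 2-transitivity of GL(n,2) on nonzero vectors

transvection : (φ u : V n) → dot φ u ≡ false → Automorphism n
transvection {n} φ u φu≡0 = record
  { to = t ; from = t ; to-⊕ = t-⊕ ; from-⊕ = t-⊕ ; to∘from = t∘t ; from∘to = t∘t }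
  where
  t : V n → V n
  t v = v ⊕ scale (dot φ v) u

  t-⊕ : ∀ v w → t (v ⊕ w) ≡ t v ⊕ t w
  t-⊕ v w = begin
    (v ⊕ w) ⊕ scale (dot φ (v ⊕ w)) u                       ≡⟨ cong (λ b → (v ⊕ w) ⊕ scale b u) (dot-⊕ʳ φ v w) ⟩
    (v ⊕ w) ⊕ scale (dot φ v xor dot φ w) u                 ≡⟨ cong ((v ⊕ w) ⊕_) (scale-xor (dot φ v) (dot φ w) u) ⟩
    (v ⊕ w) ⊕ (scale (dot φ v) u ⊕ scale (dot φ w) u)       ≡⟨ ⊕-interchange v w _ _ ⟩
    t v ⊕ t w                                               ∎

  φ-t : ∀ v → dot φ (t v) ≡ dot φ v
  φ-t v = begin
    dot φ (v ⊕ scale (dot φ v) u)              ≡⟨ dot-⊕ʳ φ v _ ⟩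
    dot φ v xor dot φ (scale (dot φ v) u)      ≡⟨ cong (dot φ v xor_) (dot-scaleʳ (dot φ v) φ u) ⟩
    dot φ v xor (dot φ v ∧ dot φ u)            ≡⟨ cong (λ b → dot φ v xor (dot φ v ∧ b)) φu≡0 ⟩
    dot φ v xor (dot φ v ∧ false)              ≡⟨ solve 1 (λ b → b :+ (b :* con false) := b) refl (dot φ v) ⟩
    dot φ v                                    ∎

  t∘t : ∀ v → t (t v) ≡ v
  t∘t v = begin
    t v ⊕ scale (dot φ (t v)) u                          ≡⟨ cong (λ b → t v ⊕ scale b u) (φ-t v) ⟩
    (v ⊕ scale (dot φ v) u) ⊕ scale (dot φ v) u          ≡⟨ ⊕-cancel-selfʳ v _ ⟩
    v                                                    ∎

transvection-fixes : ∀ (φ u : V n) p {v} → dot φ v ≡ false → to (transvection φ u p) v ≡ v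
transvection-fixes φ u p {v} φv≡0 = begin
  v ⊕ scale (dot φ v) u  ≡⟨ cong (λ b → v ⊕ scale b u) φv≡0 ⟩
  v ⊕ scale false u      ≡⟨ cong (v ⊕_) (scale-false u) ⟩
  v ⊕ 𝟎                  ≡⟨ ⊕-identityʳ v ⟩
  v                      ∎

transvection-moves : ∀ (φ u : V n) p {v} → dot φ v ≡ true → to (transvection φ u p) v ≡ v ⊕ u
transvection-moves φ u p {v} φv≡1 = begin
  v ⊕ scale (dot φ v) u  ≡⟨ cong (λ b → v ⊕ scale b u) φv≡1 ⟩
  v ⊕ scale true u       ≡⟨ cong (v ⊕_) (scale-true u) ⟩
  v ⊕ u                  ∎

dot-⊕ˡ-≡ : ∀ (φ θ v : V n) {x y} → dot φ v ≡ x → dot θ v ≡ y → dot (φ ⊕ θ) v ≡ x xor y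
dot-⊕ˡ-≡ φ θ v p q = trans (dot-⊕ˡ φ θ v) (cong₂ _xor_ p q)

nonzero-dual : {v : V n} → v ≢ 𝟎 → ∃ λ φ → dot φ v ≡ true
nonzero-dual {v = []}        v≢𝟎 = contradiction refl v≢𝟎
nonzero-dual {v = true ∷ v}  _   = true ∷ 𝟎 , cong (true xor_) (dot-𝟎ˡ v)
nonzero-dual {v = false ∷ v} v≢𝟎 with φ , p ← nonzero-dual (v≢𝟎 ∘ cong (false ∷_)) = false ∷ φ , p

-- Take φ with φ(v) = 1. If also φ(c) = 1, take θ with θ(c + v) = 1; it takes different values on c
-- and v, so θ or φ + θ has the required values. The case c = 0 is included.
separate : {c v : V n} → v ≢ 𝟎 → v ≢ c → ∃ λ φ → dot φ c ≡ false × dot φ v ≡ true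
separate {c = c} {v} v≢𝟎 v≢c with nonzero-dual v≢𝟎
... | φ , φv with dot φ c in φc
...   | false = φ , φc , φv
...   | true with nonzero-dual {v = c ⊕ v} (v≢c ∘ sym ∘ ⊕≡𝟎⇒≡)
...     | θ , θcv with dot θ c in θc | dot θ v in θv | trans (sym (dot-⊕ʳ θ c v)) θcv
...       | false | true  | _  = θ , θc , θv
...       | true  | false | _  = φ ⊕ θ , dot-⊕ˡ-≡ φ θ c φc θc , dot-⊕ˡ-≡ φ θ v φv θv
...       | true  | true  | ()
...       | false | false | ()

-- Let φ separate v from c and θ separate w from c. If φ(w) = 0 and θ(v) = 0, then φ + θ is 1 on
-- both v and w.
separate₂ : {c v w : V n} → v ≢ 𝟎 → v ≢ c → w ≢ 𝟎 → w ≢ c →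
            ∃ λ φ → dot φ c ≡ false × dot φ v ≡ true × dot φ w ≡ true
separate₂ {c = c} {v} {w} v≢𝟎 v≢c w≢𝟎 w≢c with separate v≢𝟎 v≢c | separate w≢𝟎 w≢c
... | φ , φc , φv | θ , θc , θw with dot φ w in φw | dot θ v in θv
...   | true  | _     = φ , φc , φv , φw
...   | false | true  = θ , θc , θv , θw
...   | false | false = φ ⊕ θ , dot-⊕ˡ-≡ φ θ c φc θc , dot-⊕ˡ-≡ φ θ v φv θv , dot-⊕ˡ-≡ φ θ w φw θw

-- With φ(c) = 0 and φ(v) = φ(w) = 1, the transvection along v + w fixes c and sends v to v + (v +
-- w) = w.
move : {c v w : V n} → v ≢ 𝟎 → v ≢ c → w ≢ 𝟎 → w ≢ c →
       ∃ λ (f : Automorphism n) → to f c ≡ c × to f v ≡ w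
move {c = c} {v} {w} v≢𝟎 v≢c w≢𝟎 w≢c with separate₂ v≢𝟎 v≢c w≢𝟎 w≢c
... | φ , φc , φv , φw =
  transvection φ (v ⊕ w) φu , transvection-fixes φ (v ⊕ w) φu φc ,
  trans (transvection-moves φ (v ⊕ w) φu φv) (⊕-cancel-selfˡ v w)
  where
  φu : dot φ (v ⊕ w) ≡ false
  φu = trans (dot-⊕ʳ φ v w) (cong₂ _xor_ φv φw)

-- Over F₂, two vectors are linearly independent iff they are distinct and nonzero.
Independent : V n → V n → Set
Independent u v = u ≢ 𝟎 × v ≢ 𝟎 × u ≢ v

GL-2-transitive : {a b c d : V n} → Independent a b → Independent c d →
                  ∃ λ (M : Mat n) → IsInvertible M × a ◃ M ≡ c × b ◃ M ≡ d
GL-2-transitive {n} {a} {b} {c} {d} (a≢𝟎 , b≢𝟎 , a≢b) (c≢𝟎 , d≢𝟎 , c≢d)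
  -- The fixed vector is `𝟎` here, so the only demand on `f` is that it sends `a` to `c`.
  with f , _ , fa≡c ← move a≢𝟎 a≢𝟎 c≢𝟎 c≢𝟎
  -- The second map corrects the image of `b` while keeping `c` in place.
  with g , gc≡c , gfb≡d ← move {c = c} {to f b} {d}
         (λ fb≡𝟎 → b≢𝟎 (to-injective f (trans fb≡𝟎 (sym (to-𝟎 f)))))
         (λ fb≡c → a≢b (to-injective f (trans fa≡c (sym fb≡c))))
         d≢𝟎 (c≢d ∘ sym) =
  matrix (to h) , matrix-invertible h ,
  trans (◃-matrix (to h) (to-⊕ h) a) (trans (cong (to g) fa≡c) gc≡c) ,
  trans (◃-matrix (to h) (to-⊕ h) b) gfb≡d
  where
  h : Automorphism n
  h = g ∘ᵃ f

-- The functional equation F (a + b) (c + d) = F a c + F b d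

-- The hypothesis never involves `f 𝟎`. Hence f + k may be given the value 0 at the origin, and the
-- result `f̃` is additive: the cases a = 0, b = 0 and a = b, outside the hypothesis, hold by this
-- choice.
affine-on-nonzero : (f : V n → Bool) (k : Bool) →
                    (∀ {a b} → Independent a b → f (a ⊕ b) ≡ (f a xor f b) xor k) →
                    ∃ λ β → ∀ {a} → a ≢ 𝟎 → f a ≡ dot a β xor k
affine-on-nonzero {n} f k f-⊕ = tabulate (f̃ ∘ e) , λ {a} a≢𝟎 → begin
  f a                            ≡⟨ solve 2 (λ x k → x := (x :+ k) :+ k) refl (f a) k ⟩
  (f a xor k) xor k              ≡⟨ cong (_xor k) (f̃-≢𝟎 a≢𝟎) ⟨
  f̃ a xor k                      ≡⟨ cong (_xor k) (additive⇒dot f̃ f̃-⊕ a) ⟩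
  dot a (tabulate (f̃ ∘ e)) xor k ∎
  where
  f̃ : V n → Bool
  f̃ a = if does (a ≟ᵥ 𝟎) then false else f a xor k

  f̃-𝟎 : f̃ 𝟎 ≡ false
  f̃-𝟎 = cong (if_then false else f 𝟎 xor k) (dec-true (𝟎 {n} ≟ᵥ 𝟎) refl)

  f̃-≢𝟎 : ∀ {a} → a ≢ 𝟎 → f̃ a ≡ f a xor k
  f̃-≢𝟎 {a} a≢𝟎 = cong (if_then false else f a xor k) (dec-false (a ≟ᵥ 𝟎) a≢𝟎)

  f̃-⊕ : Additive f̃
  f̃-⊕ a b = by-cases (a ≟ᵥ 𝟎) (b ≟ᵥ 𝟎) (a ≟ᵥ b)
    where
    by-cases : Dec (a ≡ 𝟎) → Dec (b ≡ 𝟎) → Dec (a ≡ b) → f̃ (a ⊕ b) ≡ f̃ a xor f̃ b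
    by-cases (yes refl) _ _ = begin
      f̃ (𝟎 ⊕ b)     ≡⟨ cong f̃ (⊕-identityˡ b) ⟩
      f̃ b           ≡⟨ cong (_xor f̃ b) f̃-𝟎 ⟨
      f̃ 𝟎 xor f̃ b   ∎
    by-cases _ (yes refl) _ = begin
      f̃ (a ⊕ 𝟎)     ≡⟨ cong f̃ (⊕-identityʳ a) ⟩
      f̃ a           ≡⟨ Bool.xor-identityʳ (f̃ a) ⟨
      f̃ a xor false ≡⟨ cong (f̃ a xor_) f̃-𝟎 ⟨
      f̃ a xor f̃ 𝟎   ∎
    by-cases _ _ (yes refl) = begin
      f̃ (a ⊕ a)     ≡⟨ cong f̃ (⊕-self a) ⟩
      f̃ 𝟎           ≡⟨ f̃-𝟎 ⟩
      false         ≡⟨ Bool.xor-same (f̃ a) ⟨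
      f̃ a xor f̃ a   ∎
    by-cases (no a≢𝟎) (no b≢𝟎) (no a≢b) = begin
      f̃ (a ⊕ b)                     ≡⟨ f̃-≢𝟎 (a≢b ∘ ⊕≡𝟎⇒≡) ⟩
      f (a ⊕ b) xor k               ≡⟨ cong (_xor k) (f-⊕ (a≢𝟎 , b≢𝟎 , a≢b)) ⟩
      ((f a xor f b) xor k) xor k   ≡⟨ solve 3 (λ x y k → ((x :+ y) :+ k) :+ k := (x :+ k) :+ (y :+ k)) refl (f a) (f b) k ⟩
      (f a xor k) xor (f b xor k)   ≡⟨ cong₂ _xor_ (f̃-≢𝟎 a≢𝟎) (f̃-≢𝟎 b≢𝟎) ⟨
      f̃ a xor f̃ b                   ∎

-- Restricted to nonzero arguments, since u and uM are nonzero together when M is invertible.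
Separated : (V n → V n → Bool) → Set
Separated {n} F = ∃₂ λ (β α : V n) → ∀ {a c} → a ≢ 𝟎 → c ≢ 𝟎 → F a c ≡ dot a β xor dot c α

-- Distinguishes dimension at least 2, where a fixed pair determines the constant `k`, from
-- dimension at most 1, where the functional equation is vacuous.
independent-pair : (n : ℕ) → (∃₂ λ (p q : V n) → Independent p q) ⊎ (∀ {p q : V n} → ¬ Independent p q)
independent-pair zero          = inj₂ none
  where
  none : ∀ {p q : V 0} → ¬ Independent p q
  none {[]} (p≢𝟎 , _) = p≢𝟎 refl
independent-pair (suc zero)    = inj₂ none
  where
  none : ∀ {p q : V 1} → ¬ Independent p q
  none {false ∷ []} {_}          (p≢𝟎 , _)     = p≢𝟎 refl
  none {true ∷ []}  {false ∷ []} (_ , q≢𝟎 , _) = q≢𝟎 refl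
  none {true ∷ []}  {true ∷ []}  (_ , _ , p≢q) = p≢q refl
independent-pair (suc (suc n)) = inj₁ (true ∷ 𝟎 , false ∷ true ∷ 𝟎 , (λ ()) , (λ ()) , (λ ()))

module FunctionalEquation (F : V (suc n) → V (suc n) → Bool)
  (F-⊕ : ∀ {a b c d} → Independent a b → Independent c d → F (a ⊕ b) (c ⊕ d) ≡ F a c xor F b d)
  where

  o : V (suc n)
  o = true ∷ 𝟎

  o≢𝟎 : o ≢ 𝟎
  o≢𝟎 ()

  -- The restrictions of `F` to the lines through the base point `o`; the summand `F o o` in `h`
  -- makes g(o) + h(c) = F(o, c).
  g h : V (suc n) → Bool
  g a = F a o
  h c = F o c xor F o o

  F-exchange : ∀ {a b c d} → Independent a b → Independent c d → F a c xor F b d ≡ F a d xor F b c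
  F-exchange {a} {b} {c} {d} ab cd@(c≢𝟎 , d≢𝟎 , c≢d) = begin
    F a c xor F b d      ≡⟨ F-⊕ ab cd ⟨
    F (a ⊕ b) (c ⊕ d)    ≡⟨ cong (F (a ⊕ b)) (⊕-comm c d) ⟩
    F (a ⊕ b) (d ⊕ c)    ≡⟨ F-⊕ ab (d≢𝟎 , c≢𝟎 , c≢d ∘ sym) ⟩
    F a d xor F b c      ∎

  -- This is `F-exchange` with b = d = o. When a or c equals o, that pair is not independent, but
  -- the identity is immediate from the definitions of `g` and `h`.
  F≡g+h : ∀ {a c} → a ≢ 𝟎 → c ≢ 𝟎 → F a c ≡ g a xor h c
  F≡g+h {a} {c} a≢𝟎 c≢𝟎 with a ≟ᵥ o | c ≟ᵥ o
  ... | yes refl | _        = solve 2 (λ x y → x := y :+ (x :+ y)) refl (F o c) (F o o)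
  ... | no _     | yes refl = solve 2 (λ x y → x := x :+ (y :+ y)) refl (F a o) (F o o)
  ... | no a≢o   | no c≢o   = begin
    F a c                          ≡⟨ xor-transposeʳ (F-exchange (a≢𝟎 , o≢𝟎 , a≢o) (c≢𝟎 , o≢𝟎 , c≢o)) ⟩
    (F a o xor F o c) xor F o o    ≡⟨ Bool.xor-assoc (F a o) (F o c) (F o o) ⟩
    g a xor h c                    ∎

  g+h-⊕ : ∀ {a b c d} → Independent a b → Independent c d →
          g (a ⊕ b) xor h (c ⊕ d) ≡ (g a xor h c) xor (g b xor h d)
  g+h-⊕ {a} {b} {c} {d} ab@(a≢𝟎 , b≢𝟎 , a≢b) cd@(c≢𝟎 , d≢𝟎 , c≢d) = begin
    g (a ⊕ b) xor h (c ⊕ d)           ≡⟨ F≡g+h (a≢b ∘ ⊕≡𝟎⇒≡) (c≢d ∘ ⊕≡𝟎⇒≡) ⟨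
    F (a ⊕ b) (c ⊕ d)                 ≡⟨ F-⊕ ab cd ⟩
    F a c xor F b d                   ≡⟨ cong₂ _xor_ (F≡g+h a≢𝟎 c≢𝟎) (F≡g+h b≢𝟎 d≢𝟎) ⟩
    (g a xor h c) xor (g b xor h d)   ∎

  -- Both laws carry the same `k`, so it occurs twice in g(a) + h(c) and cancels.
  separated-with : (k : Bool) →
    (∀ {a b} → Independent a b → g (a ⊕ b) ≡ (g a xor g b) xor k) →
    (∀ {c d} → Independent c d → h (c ⊕ d) ≡ (h c xor h d) xor k) →
    Separated F
  separated-with k g-⊕ h-⊕ = combine (affine-on-nonzero g k g-⊕) (affine-on-nonzero h k h-⊕)
    where
    cancel-k : ∀ x y → (x xor k) xor (y xor k) ≡ x xor y
    cancel-k x y = solve 3 (λ x y k → (x :+ k) :+ (y :+ k) := x :+ y) refl x y k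

    combine : (∃ λ β → ∀ {a} → a ≢ 𝟎 → g a ≡ dot a β xor k) →
              (∃ λ α → ∀ {c} → c ≢ 𝟎 → h c ≡ dot c α xor k) → Separated F
    combine (β , gβ) (α , hα) = β , α , λ {a} {c} a≢𝟎 c≢𝟎 → begin
      F a c                                 ≡⟨ F≡g+h a≢𝟎 c≢𝟎 ⟩
      g a xor h c                           ≡⟨ cong₂ _xor_ (gβ a≢𝟎) (hα c≢𝟎) ⟩
      (dot a β xor k) xor (dot c α xor k)   ≡⟨ cancel-k (dot a β) (dot c α) ⟩
      dot a β xor dot c α                   ∎

  separated : Separated F
  separated with independent-pair (suc n)
  -- Without independent pairs both laws are vacuous, and any constant would do.
  ... | inj₂ none = separated-with false (λ ab → contradiction ab none) (λ cd → contradiction cd none)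
  ... | inj₁ (p , q , pq) = separated-with k g-⊕ h-⊕
    where
    -- The defect of additivity of `h` at one fixed pair. Comparing with that pair in `g+h-⊕` gives
    -- every defect of `g` this value; comparing back with the defect of `g` at (p, q) gives it to
    -- every defect of `h`.
    k : Bool
    k = h (p ⊕ q) xor (h p xor h q)

    g-⊕ : ∀ {a b} → Independent a b → g (a ⊕ b) ≡ (g a xor g b) xor k
    g-⊕ {a} {b} ab = begin
      g (a ⊕ b)                                          ≡⟨ xor-transposeʳ (g+h-⊕ ab pq) ⟩
      ((g a xor h p) xor (g b xor h q)) xor h (p ⊕ q)    ≡⟨ solve 5 (λ x y z u v →
        ((x :+ z) :+ (y :+ u)) :+ v := (x :+ y) :+ (v :+ (z :+ u))) refl (g a) (g b) (h p) (h q) (h (p ⊕ q)) ⟩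
      (g a xor g b) xor k                                ∎

    h-⊕ : ∀ {c d} → Independent c d → h (c ⊕ d) ≡ (h c xor h d) xor k
    h-⊕ {c} {d} cd = begin
      h (c ⊕ d)                                          ≡⟨ xor-transposeʳ (trans (Bool.xor-comm (h (c ⊕ d)) (g (p ⊕ q))) (g+h-⊕ pq cd)) ⟩
      ((g p xor h c) xor (g q xor h d)) xor g (p ⊕ q)    ≡⟨ cong (((g p xor h c) xor (g q xor h d)) xor_) (g-⊕ pq) ⟩
      ((g p xor h c) xor (g q xor h d)) xor ((g p xor g q) xor k) ≡⟨ solve 5 (λ x y z u k →
        ((x :+ z) :+ (y :+ u)) :+ ((x :+ y) :+ k) := (z :+ u) :+ k) refl (g p) (g q) (h c) (h d) k ⟩
      (h c xor h d) xor k                                ∎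

-- Intersecting sets

linear : AGL n → Mat n
linear = proj₁ ∘ elt

shift : AGL n → V n
shift = proj₂ ∘ elt

-- If w is fixed by g h⁻¹, the elements agree at h⁻¹(w), which is N(v₂ + w) for h = (M₂, v₂) and N
-- the inverse of M₂.
intersect⇒agree : (g h : AGL n) → Intersect g h → ∃ λ x → act (elt g) x ≡ act (elt h) x
intersect⇒agree ((M₁ , v₁) , _) ((M₂ , v₂) , N , M₂N≡I , _) (w , fixed) = N ·ᵥ (v₂ ⊕ w) , (begin
  v₁ ⊕ (M₁ ·ᵥ (N ·ᵥ (v₂ ⊕ w)))                          ≡⟨ cong (v₁ ⊕_) (·ₘ-·ᵥ M₁ N (v₂ ⊕ w)) ⟨
  v₁ ⊕ ((M₁ ·ₘ N) ·ᵥ (v₂ ⊕ w))                          ≡⟨ cong (v₁ ⊕_) (·ᵥ-⊕ (M₁ ·ₘ N) v₂ w) ⟩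
  v₁ ⊕ (((M₁ ·ₘ N) ·ᵥ v₂) ⊕ ((M₁ ·ₘ N) ·ᵥ w))           ≡⟨ ⊕-assoc v₁ _ _ ⟨
  (v₁ ⊕ ((M₁ ·ₘ N) ·ᵥ v₂)) ⊕ ((M₁ ·ₘ N) ·ᵥ w)           ≡⟨ cong (λ u → (v₁ ⊕ u) ⊕ ((M₁ ·ₘ N) ·ᵥ w)) (·ₘ-·ᵥ M₁ N v₂) ⟩
  (v₁ ⊕ (M₁ ·ᵥ (N ·ᵥ v₂))) ⊕ ((M₁ ·ₘ N) ·ᵥ w)           ≡⟨ fixed ⟩
  w                                                     ≡⟨ ⊕-cancel-selfˡ v₂ w ⟨
  v₂ ⊕ (v₂ ⊕ w)                                         ≡⟨ cong (v₂ ⊕_) (I-·ᵥ (v₂ ⊕ w)) ⟨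
  v₂ ⊕ (I ·ᵥ (v₂ ⊕ w))                                  ≡⟨ cong (λ A → v₂ ⊕ (A ·ᵥ (v₂ ⊕ w))) M₂N≡I ⟨
  v₂ ⊕ ((M₂ ·ₘ N) ·ᵥ (v₂ ⊕ w))                          ≡⟨ cong (v₂ ⊕_) (·ₘ-·ᵥ M₂ N (v₂ ⊕ w)) ⟩
  v₂ ⊕ (M₂ ·ᵥ (N ·ᵥ (v₂ ⊕ w)))                          ∎)

dot-act : (u : V n) (g : AGL n) (x : V n) →
          dot u (act (elt g) x) ≡ dot u (shift g) xor dot (u ◃ linear g) x
dot-act u g x = begin
  dot u (act (elt g) x)                              ≡⟨ dot-⊕ʳ u (shift g) _ ⟩
  dot u (shift g) xor dot u (linear g ·ᵥ x)          ≡⟨ cong (dot u (shift g) xor_) (dot-◃ u (linear g) x) ⟨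
  dot u (shift g) xor dot (u ◃ linear g) x           ∎

-- At a common point x both values satisfy u(gx) = uv + (uM)x; the terms (uM)x coincide and cancel.
intersect⇒dot-shift : (g h : AGL n) → Intersect g h →
                      ∀ u → u ◃ linear g ≡ u ◃ linear h → dot u (shift g) ≡ dot u (shift h)
intersect⇒dot-shift g h gh u p with x , gx≡hx ← intersect⇒agree g h gh =
  xor-cancelʳ (dot (u ◃ linear h) x) (begin
    dot u (shift g) xor dot (u ◃ linear h) x   ≡⟨ cong (λ v → dot u (shift g) xor dot v x) p ⟨
    dot u (shift g) xor dot (u ◃ linear g) x   ≡⟨ dot-act u g x ⟨
    dot u (act (elt g) x)                      ≡⟨ cong (dot u) gx≡hx ⟩
    dot u (act (elt h) x)                      ≡⟨ dot-act u h x ⟩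
    dot u (shift h) xor dot (u ◃ linear h) x   ∎)

-- With equal linear parts every row u qualifies in `intersect⇒dot-shift`, so the shifts agree. Thus
-- `linear` is injective on an intersecting set.
intersect⇒elt-≡ : (g h : AGL n) → Intersect g h → linear g ≡ linear h → elt g ≡ elt h
intersect⇒elt-≡ g h gh p =
  cong₂ _,_ p (dot-ext λ u → intersect⇒dot-shift g h gh u (cong (u ◃_) p))

fixing-𝟎⇒intersect : (g h : AGL n) → shift g ≡ 𝟎 → shift h ≡ 𝟎 → Intersect g h
fixing-𝟎⇒intersect ((M₁ , _) , _) ((M₂ , _) , N , _) refl refl = 𝟎 , (begin
  (𝟎 ⊕ (M₁ ·ᵥ (N ·ᵥ 𝟎))) ⊕ ((M₁ ·ₘ N) ·ᵥ 𝟎)   ≡⟨ cong₂ _⊕_ (⊕-identityˡ _) (·ᵥ-𝟎 (M₁ ·ₘ N)) ⟩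
  (M₁ ·ᵥ (N ·ᵥ 𝟎)) ⊕ 𝟎                        ≡⟨ ⊕-identityʳ _ ⟩
  M₁ ·ᵥ (N ·ᵥ 𝟎)                              ≡⟨ cong (M₁ ·ᵥ_) (·ᵥ-𝟎 N) ⟩
  M₁ ·ᵥ 𝟎                                     ≡⟨ ·ᵥ-𝟎 M₁ ⟩
  𝟎                                           ∎)

AllPairs-map-∈ : ∀ {a r q} {A : Set a} {R : A → A → Set r} {Q : A → A → Set q} {xs} →
                 (∀ {x y} → x ∈ xs → y ∈ xs → R x y → Q x y) → AllPairs R xs → AllPairs Q xs
AllPairs-map-∈ f []         = []
AllPairs-map-∈ f (rs ∷ rss) =
  All.tabulate (λ y∈ → f (here refl) (there y∈) (All.lookup rs y∈)) ∷
  AllPairs-map-∈ (λ x∈ y∈ → f (there x∈) (there y∈)) rss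

linearPart : AGL n → AGL n
linearPart ((M , _) , M-inv) = (M , 𝟎) , M-inv

-- Otherwise the linear parts of S together with M would form a larger
-- intersecting set, all of whose elements fix 𝟎.
maximum⇒covers-GL : (S : List (AGL n)) → IsMaxIntersecting S →
                    (M : Mat n) → IsInvertible M → ∃ λ g → g ∈ S × linear g ≡ M
maximum⇒covers-GL {n} S (distinct , intersecting , maximum) M M-inv =
  find (decidable-stable (any? (λ g → Vec.≡-dec _≟ᵥ_ (linear g) M) S) λ M∉S →
    1+n≰n (subst (λ l → suc l ≤ length S) (List.length-map linearPart S)
      (maximum T (T-distinct M∉S) T-intersecting)))
  where
  T : List (AGL n)
  T = ((M , 𝟎) , M-inv) ∷ List.map linearPart S

  T-distinct : ¬ Any (λ g → linear g ≡ M) S → Distinct T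
  T-distinct M∉S =
    All.map⁺ (All.tabulate λ g∈S p → M∉S (lose g∈S (sym (cong proj₁ p)))) ∷
    AllPairs.map⁺ (AllPairs-map-∈
      (λ {g} {h} g∈S h∈S g≢h p → g≢h (intersect⇒elt-≡ g h (intersecting g∈S h∈S) (cong proj₁ p)))
      distinct)

  T-shift : ∀ {g} → g ∈ T → shift g ≡ 𝟎
  T-shift (here refl) = refl
  T-shift (there g∈)  with _ , _ , refl ← ∈-map⁻ linearPart g∈ = refl

  T-intersecting : IsIntersecting T
  T-intersecting {g} {h} g∈T h∈T = fixing-𝟎⇒intersect g h (T-shift g∈T) (T-shift h∈T)

-- From a maximum intersecting set to a canonical one

module MaximumIntersecting (S : List (AGL (suc n))) (S-max : IsMaxIntersecting S) where

  intersecting : IsIntersecting S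
  intersecting = proj₁ (proj₂ S-max)

  F : V (suc n) → V (suc n) → Bool
  F u w with any? (λ g → (u ◃ linear g) ≟ᵥ w) S
  ... | yes p = dot u (shift (proj₁ (find p)))
  -- A default for pairs that no member of `S` realises; `F-shift` concerns only realised pairs.
  ... | no _  = false

  -- Well-definedness of `F`: the member found by the search may differ from `g`, but the two
  -- intersect and act alike on u.
  F-shift : ∀ {g} → g ∈ S → ∀ u {w} → u ◃ linear g ≡ w → F u w ≡ dot u (shift g)
  F-shift {g} g∈S u {w} ug≡w with any? (λ g → (u ◃ linear g) ≟ᵥ w) S
  ... | no none = contradiction (lose g∈S ug≡w) none
  ... | yes p with h , h∈S , uh≡w ← find p =
    intersect⇒dot-shift h g (intersecting h∈S g∈S) u (trans uh≡w (sym ug≡w))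

  -- A single member realises all three pairs, and uv is linear in u.
  F-⊕-at : ∀ {g} → g ∈ S → ∀ a b {c d} → a ◃ linear g ≡ c → b ◃ linear g ≡ d →
           F (a ⊕ b) (c ⊕ d) ≡ F a c xor F b d
  F-⊕-at {g} g∈S a b {c} {d} ag≡c bg≡d = begin
    F (a ⊕ b) (c ⊕ d)                     ≡⟨ F-shift g∈S (a ⊕ b) (trans (◃-⊕ a b (linear g)) (cong₂ _⊕_ ag≡c bg≡d)) ⟩
    dot (a ⊕ b) (shift g)                 ≡⟨ dot-⊕ˡ a b (shift g) ⟩
    dot a (shift g) xor dot b (shift g)   ≡⟨ cong₂ _xor_ (F-shift g∈S a ag≡c) (F-shift g∈S b bg≡d) ⟨
    F a c xor F b d                       ∎

  F-⊕ : ∀ {a b c d} → Independent a b → Independent c d → F (a ⊕ b) (c ⊕ d) ≡ F a c xor F b d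
  F-⊕ {a} {b} {c} {d} ab cd = at (GL-2-transitive ab cd)
    where
    at : (∃ λ M → IsInvertible M × a ◃ M ≡ c × b ◃ M ≡ d) → F (a ⊕ b) (c ⊕ d) ≡ F a c xor F b d
    at (M , M-inv , aM≡c , bM≡d) =
      let g , g∈S , g≡M = maximum⇒covers-GL S S-max M M-inv
      in F-⊕-at g∈S a b (trans (cong (a ◃_) g≡M) aM≡c) (trans (cong (b ◃_) g≡M) bM≡d)

  separated⇒canonical : Separated F → IsCanonical S
  separated⇒canonical (β , α , F≡) = α , β , λ g → mk⇔ (to-canonical g) (from-canonical g)
    where
    -- For nonzero u and g = (M, v), u(gα) = F(u, uM) + (uM)α = uβ, where (uM)α occurs twice and
    -- cancels.
    act-α : ∀ {g} → g ∈ S → act (elt g) α ≡ β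
    act-α {g} g∈S = dot-ext λ u → by-cases u (u ≟ᵥ 𝟎)
      where
      by-cases : ∀ u → Dec (u ≡ 𝟎) → dot u (act (elt g) α) ≡ dot u β
      by-cases u (yes u≡𝟎) = begin
        dot u (act (elt g) α)  ≡⟨ cong (λ u → dot u (act (elt g) α)) u≡𝟎 ⟩
        dot 𝟎 (act (elt g) α)  ≡⟨ dot-𝟎ˡ (act (elt g) α) ⟩
        false                  ≡⟨ dot-𝟎ˡ β ⟨
        dot 𝟎 β                ≡⟨ cong (λ u → dot u β) u≡𝟎 ⟨
        dot u β                ∎
      by-cases u (no u≢𝟎)   = begin
        dot u (act (elt g) α)                   ≡⟨ dot-act u g α ⟩
        dot u (shift g) xor dot w α             ≡⟨ cong (_xor dot w α) (F-shift g∈S u refl) ⟨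
        F u w xor dot w α                       ≡⟨ cong (_xor dot w α) (F≡ u≢𝟎 (◃-≢𝟎 (proj₂ g) u≢𝟎)) ⟩
        (dot u β xor dot w α) xor dot w α       ≡⟨ xor-transposeʳ {dot u β} {dot w α} refl ⟨
        dot u β                                 ∎
        where w = u ◃ linear g

    to-canonical : ∀ g → g ∈G S → act (elt g) α ≡ β
    to-canonical g g∈GS =
      let h , h∈S , h≡g = find g∈GS
      in subst (λ p → act p α ≡ β) h≡g (act-α h∈S)

    -- Some member has the same linear part `M` and also sends α to β; both shifts are then β + Mα.
    from-canonical : ∀ g → act (elt g) α ≡ β → g ∈G S
    from-canonical ((M , v) , M-inv) gα≡β =
      let h , h∈S , h≡M = maximum⇒covers-GL S S-max M M-inv
      in lose h∈S (cong₂ _,_ h≡M (same-shift h h∈S h≡M))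
      where
      same-shift : ∀ h → h ∈ S → linear h ≡ M → shift h ≡ v
      same-shift h h∈S h≡M = begin
        shift h                                    ≡⟨ ⊕-cancel-selfʳ (shift h) (linear h ·ᵥ α) ⟨
        act (elt h) α ⊕ (linear h ·ᵥ α)            ≡⟨ cong₂ (λ w A → w ⊕ (A ·ᵥ α)) (trans (act-α h∈S) (sym gα≡β)) h≡M ⟩
        (v ⊕ (M ·ᵥ α)) ⊕ (M ·ᵥ α)                  ≡⟨ ⊕-cancel-selfʳ v (M ·ᵥ α) ⟩
        v                                          ∎

  canonical : IsCanonical S
  canonical = separated⇒canonical (FunctionalEquation.separated F F-⊕)

theorem1p1 : (n : ℕ) → 1 ≤ n → StrictEKR n
theorem1p1 (suc n) _ S S-max = MaximumIntersecting.canonical S S-max
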